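{- Given an $n$-vertex graph $G$, we can construct in polynomial time another graph $H$ on $n^3 + n$ vertices such that $G$ has a vertex cover of size $c$ if and only if $H$ has a fill-in of size at most $(c+1)n^2 - 1$.
   Context: All graphs are undirected and simple. A vertex cover of a graph $G$ is a set of vertices such that every edge of $G$ has at least one end in the set. A graph is chordal if it has no induced cycle of length at least four. A fill-in of a graph $H$ is a set $E_+$ of non-edges of $H$ such that $H + E_+$ (the graph with vertex set $V(H)$ and edge set $E(H)\cup E_+$) is chordal.
   Formalization: The equivalence is stated for n ≥ 1 and c ≤ n: for n = 0, c = 0 the bound is −1 although the empty cover exists, and for c > n no vertex cover of size exactly c exists although H always has a fill-in within the bound. -}

module Defs where

open import Data.Bool using (Bool; true; false; _∨_; T; if_then_else_)
open import Data.Bool.Properties using (T?)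
open import Data.Fin using (Fin; toℕ; _<?_)
open import Data.Fin.Subset using (Subset; _∈_; ∣_∣)
open import Data.List using (List; []; _∷_; _++_; [_]; map; length; filter; allFin; cartesianProduct)
open import Data.Nat using (ℕ; suc; _+_; _*_; _∸_; _^_; _≤_; NonZero; _≡ᵇ_; _%_)
open import Data.Product using (Σ; ∃-syntax; _×_; _,_; proj₁; proj₂)
open import Data.Sum using (_⊎_)
open import Function.Bundles using (_⇔_)
open import Function.Definitions using (Injective)
open import Relation.Binary.PropositionalEquality using (_≡_; cong₂)
open import Relation.Nullary using (¬_)
open import Relation.Nullary.Decidable using (_×-dec_)

-- A set of unordered pairs of distinct elements of Fin n.
record EdgeSet (n : ℕ) : Set where
  field
    has    : Fin n → Fin n → Bool
    sym    : ∀ u v → has u v ≡ has v u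
    irrefl : ∀ v → has v v ≡ false

open EdgeSet public

-- Each unordered pair is counted once, through its ordered form u < v.
edgeList : ∀ {n} → EdgeSet n → List (Fin n × Fin n)
edgeList {n} F =
  filter (λ e → (proj₁ e <? proj₂ e) ×-dec T? (has F (proj₁ e) (proj₂ e)))
         (cartesianProduct (allFin n) (allFin n))

size : ∀ {n} → EdgeSet n → ℕ
size F = length (edgeList F)

record Graph (n : ℕ) : Set where
  constructor graph
  field
    E : EdgeSet n

open Graph public

Adj : ∀ {n} → Graph n → Fin n → Fin n → Set
Adj G u v = T (has (E G) u v)

_∪ₑ_ : ∀ {n} → EdgeSet n → EdgeSet n → EdgeSet n
has    (A ∪ₑ B) u v = has A u v ∨ has B u v
sym    (A ∪ₑ B) u v = cong₂ _∨_ (sym A u v) (sym B u v)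
irrefl (A ∪ₑ B) v   = cong₂ _∨_ (irrefl A v) (irrefl B v)

infixl 6 _⊕_

_⊕_ : ∀ {n} → Graph n → EdgeSet n → Graph n
G ⊕ F = graph (E G ∪ₑ F)

IsVertexCover : ∀ {n} → Graph n → Subset n → Set
IsVertexCover G S = ∀ u v → Adj G u v → u ∈ S ⊎ v ∈ S

HasVertexCoverOfSize : ∀ {n} → Graph n → ℕ → Set
HasVertexCoverOfSize G c = ∃[ S ] (IsVertexCover G S × ∣ S ∣ ≡ c)

-- j is the successor of i in the cyclic order 0, 1, …, k - 1, 0.
Next : ∀ {k} .{{_ : NonZero k}} → Fin k → Fin k → Set
Next {k} i j = toℕ j ≡ suc (toℕ i) % k

-- For k ≥ 3, an induced cycle of length k, listed in cyclic order.
InducedCycle : ∀ {n} → Graph n → (k : ℕ) .{{_ : NonZero k}} → Set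
InducedCycle {n} G k =
  Σ (Fin k → Fin n) λ f →
    Injective _≡_ _≡_ f × (∀ i j → Adj G (f i) (f j) ⇔ (Next i j ⊎ Next j i))

Chordal : ∀ {n} → Graph n → Set
Chordal G = ∀ k .{{_ : NonZero k}} → 4 ≤ k → ¬ InducedCycle G k

IsFillIn : ∀ {n} → Graph n → EdgeSet n → Set
IsFillIn H F = (∀ u v → T (has F u v) → ¬ Adj H u v) × Chordal (H ⊕ F)

HasFillInOfSizeAtMost : ∀ {n} → Graph n → ℕ → Set
HasFillInOfSizeAtMost H m = ∃[ F ] (IsFillIn H F × size F ≤ m)

-- The instruction set is that of Cook and Reckhow (Time bounded random
-- access machines, 1973), over ℕ with truncated subtraction and with
-- structured control flow in place of jumps.  There is no multiplication,
-- so unit-cost time is polynomially related to Turing machine time.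

-- Registers X₀, X₁, X₂, … are named by their index.
data Instr : Set where
  const : (i c : ℕ) → Instr      -- Xᵢ ← c
  add   : (i j k : ℕ) → Instr    -- Xᵢ ← Xⱼ + Xₖ
  sub   : (i j k : ℕ) → Instr    -- Xᵢ ← Xⱼ ∸ Xₖ
  load  : (i j : ℕ) → Instr      -- Xᵢ ← X[Xⱼ]
  store : (i j : ℕ) → Instr      -- X[Xᵢ] ← Xⱼ
  read  : (i : ℕ) → Instr        -- Xᵢ ← next input item, 0 if there is none
  print : (i : ℕ) → Instr        -- append Xᵢ to the output

infixr 5 _⨾_

-- Both tests ask whether the given register is positive.
data Program : Set where
  instr : Instr → Program
  _⨾_   : Program → Program → Program
  cond  : (i : ℕ) → Program → Program → Program
  while : (i : ℕ) → Program → Program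

record State : Set where
  constructor ⟨_,_,_⟩
  field
    reg    : ℕ → ℕ
    input  : List ℕ
    output : List ℕ

open State public

_[_↦_] : (ℕ → ℕ) → ℕ → ℕ → (ℕ → ℕ)
(X [ i ↦ x ]) j = if i ≡ᵇ j then x else X j

execute : Instr → State → State
execute (const i c) ⟨ X , is , os ⟩     = ⟨ X [ i ↦ c ] , is , os ⟩
execute (add i j k) ⟨ X , is , os ⟩     = ⟨ X [ i ↦ X j + X k ] , is , os ⟩
execute (sub i j k) ⟨ X , is , os ⟩     = ⟨ X [ i ↦ X j ∸ X k ] , is , os ⟩
execute (load i j)  ⟨ X , is , os ⟩     = ⟨ X [ i ↦ X (X j) ] , is , os ⟩
execute (store i j) ⟨ X , is , os ⟩     = ⟨ X [ X i ↦ X j ] , is , os ⟩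
execute (read i)    ⟨ X , [] , os ⟩     = ⟨ X [ i ↦ 0 ] , [] , os ⟩
execute (read i)    ⟨ X , x ∷ is , os ⟩ = ⟨ X [ i ↦ x ] , is , os ⟩
execute (print i)   ⟨ X , is , os ⟩     = ⟨ X , is , os ++ [ X i ] ⟩

-- Run p s t s′: started in s, the program p halts in s′ after exactly t
-- steps, each instruction and each test being one step.
data Run : Program → State → ℕ → State → Set where
  run-instr : ∀ {a s} → Run (instr a) s 1 (execute a s)
  run-⨾     : ∀ {p q s s′ s″ t t′} →
              Run p s t s′ → Run q s′ t′ s″ → Run (p ⨾ q) s (t + t′) s″
  run-then  : ∀ {i p q s s′ t} → 1 ≤ reg s i →
              Run p s t s′ → Run (cond i p q) s (suc t) s′
  run-else  : ∀ {i p q s s′ t} → reg s i ≡ 0 →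
              Run q s t s′ → Run (cond i p q) s (suc t) s′
  run-stop  : ∀ {i p s} → reg s i ≡ 0 → Run (while i p) s 1 s
  run-loop  : ∀ {i p s s′ s″ t t′} → 1 ≤ reg s i →
              Run p s t s′ → Run (while i p) s′ t′ s″ →
              Run (while i p) s (suc (t + t′)) s″

initial : List ℕ → State
initial is = ⟨ (λ _ → 0) , is , [] ⟩

bit : Bool → ℕ
bit b = if b then 1 else 0

encode : ∀ {n} → Graph n → List ℕ
encode {n} G =
  n ∷ map (λ e → bit (has (E G) (proj₁ e) (proj₂ e)))
          (cartesianProduct (allFin n) (allFin n))

-- One program serves all n.  The bound a ℓ ^ k + b is in the input length
-- ℓ = n ^ 2 + 1, and no input item exceeds ℓ, so unit-cost is legitimate.
PolynomialTime : {f : ℕ → ℕ} → (∀ n → Graph n → Graph (f n)) → Set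
PolynomialTime F =
  Σ Program λ p → ∃[ a ] ∃[ b ] ∃[ k ]
    ∀ n (G : Graph n) → ∃[ t ] ∃[ s ]
      ( Run p (initial (encode G)) t s
      × output s ≡ encode (F n G)
      × t ≤ a * length (encode G) ^ k + b )

{-# OPTIONS --safe #-}
-- The vertices of H are a copy of V(G), carrying G, and for each u ∈ V(G) a
-- block of n ^ 2 vertices.  The blocks form one clique, and u is joined to
-- every block but its own.  For an edge uv of G, a vertex a of the block of u
-- and b of that of v, the cycle u v a b is induced, and its chords are ua and
-- vb; so a fill-in joins u or v to its entire block.  The vertices joined to
-- their entire blocks therefore form a vertex cover, each costing n ^ 2 fill
-- edges.  Conversely, joining each vertex of a vertex cover S to its block and
-- turning S into a clique yields a split graph, hence a chordal one; the
-- clique costs fewer than n ^ 2 edges.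
--
-- H can be printed row by row in a single pass over the input, because the
-- adjacency matrix of G is its last diagonal block.
module Submission where

open import Defs
open import Data.Bool using (Bool; true; false; not; _∧_; _∨_; T)
open import Data.Bool.Properties using (∧-comm; T?; T-∧; T-∨)
open import Data.Empty using (⊥; ⊥-elim)
open import Data.Fin using (Fin; zero; suc; toℕ; _↑ˡ_; _↑ʳ_; combine; remQuot; splitAt)
open import Data.Fin.Patterns using (0F; 1F; 2F; 3F; 4F)
import Data.Fin.Properties as Fin
open import Data.Fin.Subset using (Subset; inside; outside; ∣_∣; _∈_; _⊆_)
open import Data.Fin.Subset.Properties using (_∈?_; ∣p∣≤n)
open import Data.List using (List; []; _∷_; _++_; [_]; map; length; concat; tabulate; allFin; cartesianProduct; drop)
import Data.List.Membership.Propositional as List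
open import Data.List.Membership.Propositional.Properties
open import Data.List.Properties using (++-assoc; ++-identityʳ; tabulate-cong; map-++; map-∘; map-tabulate; length-map; length-tabulate; length-++; length-drop)
import Data.List.Relation.Unary.All as All
open import Data.List.Relation.Unary.AllPairs using ([]; _∷_)
open import Data.List.Relation.Unary.Any using (here; there)
open import Data.List.Relation.Unary.Unique.Propositional using (Unique)
import Data.List.Relation.Unary.Unique.Propositional.Properties as Unique
open import Data.Nat
open import Data.Nat.Properties
open import Data.Product using (Σ; ∃-syntax; _×_; _,_; proj₁; proj₂)
import Data.Sum as Sum
open import Data.Sum using (_⊎_; inj₁; inj₂; map₁; [_,_]′)
open import Data.Unit using (⊤; tt)
import Data.Vec as Vec
open import Data.Vec using ([]; _∷_; here; there)
import Data.Vec.Properties as Vec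
open import Function using (_∘_; case_of_)
open import Function.Bundles using (_⇔_; mk⇔; module Equivalence)
open import Relation.Binary.PropositionalEquality as ≡ using (_≡_; _≢_; refl; trans; cong; cong₂; subst)
open import Relation.Nullary using (¬_; yes; no; does; Dec)
open import Relation.Nullary.Decidable using (dec-true)

open Equivalence using (to; from)

-- Verification of random access machine programs

Assertion : Set₁
Assertion = (ℕ → ℕ) → Set

-- Total correctness with accounting of time, input and output. As `rest` is arbitrary and output
-- grows only at its end, sequencing two programs concatenates `is` and `os` and adds the time
-- bounds.
Triple : ℕ → Assertion → List ℕ → Program → List ℕ → Assertion → Set
Triple T P is p os Q =
  ∀ s rest → P (reg s) → input s ≡ is ++ rest →
    ∃[ t ] ∃[ s′ ] ( Run p s t s′ × Q (reg s′) × input s′ ≡ rest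
                   × output s′ ≡ output s ++ os × t ≤ T )

-- The assignment rules read backwards, as in Hoare logic. At literal register numbers the updated
-- register file reduces, so most preconditions, and stability under writes to registers not
-- mentioned, hold by computation.
const-rule : ∀ {i c Q} → Triple 1 (λ X → Q (X [ i ↦ c ])) [] (instr (const i c)) [] Q
const-rule s rest P eq = 1 , _ , run-instr , P , eq , ≡.sym (++-identityʳ _) , ≤-refl

add-rule : ∀ {i j k Q} → Triple 1 (λ X → Q (X [ i ↦ X j + X k ])) [] (instr (add i j k)) [] Q
add-rule s rest P eq = 1 , _ , run-instr , P , eq , ≡.sym (++-identityʳ _) , ≤-refl

sub-rule : ∀ {i j k Q} → Triple 1 (λ X → Q (X [ i ↦ X j ∸ X k ])) [] (instr (sub i j k)) [] Q
sub-rule s rest P eq = 1 , _ , run-instr , P , eq , ≡.sym (++-identityʳ _) , ≤-refl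

read-rule : ∀ {i x Q} → Triple 1 (λ X → Q (X [ i ↦ x ])) [ x ] (instr (read i)) [] Q
read-rule ⟨ X , _ , out ⟩ rest P refl =
  1 , _ , run-instr , P , refl , ≡.sym (++-identityʳ _) , ≤-refl

print-rule : ∀ {i x} {P : Assertion} → (∀ X → P X → X i ≡ x) → Triple 1 P [] (instr (print i)) [ x ] P
print-rule val s rest P eq =
  1 , _ , run-instr , P , eq , cong (λ x → output s ++ [ x ]) (val _ P) , ≤-refl

⨾-rule : ∀ {T T′ P Q R is is′ os os′ p q} →
         Triple T P is p os Q → Triple T′ Q is′ q os′ R →
         Triple (T + T′) P (is ++ is′) (p ⨾ q) (os ++ os′) R
⨾-rule {is = is} {is′} {os} {os′} p-ok q-ok s rest P eq
  with p-ok s (is′ ++ rest) P (trans eq (++-assoc is is′ rest))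
... | t , s′ , run , Q , in′ , out′ , t≤T with q-ok s′ rest Q in′
... | t′ , s″ , run′ , R , in″ , out″ , t′≤T′ =
  t + t′ , s″ , run-⨾ run run′ , R , in″ ,
  trans out″ (trans (cong (_++ os′) out′) (++-assoc (output s) os os′)) ,
  +-mono-≤ t≤T t′≤T′

consequence : ∀ {T P P′ Q Q′ is p os} →
              (∀ X → P X → P′ X) → (∀ X → Q′ X → Q X) →
              Triple T P′ is p os Q′ → Triple T P is p os Q
consequence pre post ok s rest P eq with ok s rest (pre _ P) eq
... | t , s′ , run , Q′ , rest-ok = t , s′ , run , post _ Q′ , rest-ok

strengthen : ∀ {T P P′ Q is p os} →
      (∀ X → P X → P′ X) → Triple T P′ is p os Q → Triple T P is p os Q
strengthen f = consequence f (λ _ q → q)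

infix 6 ⨆_

⨆_ : ∀ {a} {A : Set a} {n} → (Fin n → List A) → List A
⨆ f = concat (tabulate f)

lookup-update : ∀ X i {x} → (X [ i ↦ x ]) i ≡ x
lookup-update X zero    = refl
lookup-update X (suc i) = lookup-update (X ∘ suc) i

lookup-other : ∀ X i j {x} → (i ≡ᵇ j) ≡ false → (X [ i ↦ x ]) j ≡ X j
lookup-other X i j eq rewrite eq = refl

-- Xᵢ runs through 0, 1, …, Xₘ ∸ 1 while X_d = Xₘ ∸ Xᵢ; X₁ has to hold 1.
loop : (i d m : ℕ) → Program → Program
loop i d m p = while d (p ⨾ instr (add i i 1) ⨾ instr (sub d m i))

for : (i d m : ℕ) → Program → Program
for i d m p = instr (const i 0) ⨾ instr (sub d m i) ⨾ loop i d m p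

-- Two initialising instructions and the final failing test; each iteration adds one test and two
-- counter updates to the body. The nesting is that of the sums produced by `⨾-rule`.
for-time : ℕ → ℕ → ℕ
for-time r T = 1 + (1 + (1 + r * (3 + T)))

Stable : Assertion → ℕ → Set
Stable P i = ∀ X x → P X → P (X [ i ↦ x ])

module _ {i d m M T : ℕ} {p : Program} (P : ℕ → Assertion)
  (i-stable : ∀ k → Stable (P k) i) (d-stable : ∀ k → Stable (P k) d)
  (d≢i : (d ≡ᵇ i) ≡ false)
  (one : ∀ k X → P k X → X 1 ≡ 1) (bound : ∀ k X → P k X → X m ≡ M)
  where

  private
    -- The index of `P` counts finished iterations. The counter still holds `v` after the body,
    -- since `loop` increments it only then.
    Body : List ℕ → List ℕ → ℕ → Set
    Body is os v = Triple T (λ X → P v X × X i ≡ v) is p os (λ X → P (suc v) X × X i ≡ v)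

    AtHead : ℕ → Assertion
    AtHead o X = P o X × X i ≡ o × X d ≡ M ∸ o

    advance : ∀ o → Triple 2 (λ X → P (suc o) X × X i ≡ o) []
                (instr (add i i 1) ⨾ instr (sub d m i)) [] (AtHead (suc o))
    advance o = strengthen step (⨾-rule add-rule (sub-rule {Q = AtHead (suc o)}))
      where
      step : ∀ X → P (suc o) X × X i ≡ o →
             let Y = X [ i ↦ X i + X 1 ] in AtHead (suc o) (Y [ d ↦ Y m ∸ Y i ])
      step X (inv , Xi≡o) = d-stable _ _ _ inv′ , trans (lookup-other Y d i d≢i) Yi≡ ,
        trans (lookup-update Y d) (cong₂ _∸_ (bound _ _ inv′) Yi≡)
        where
        Y    = X [ i ↦ X i + X 1 ]
        inv′ = i-stable _ _ (X i + X 1) inv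
        Yi≡  : Y i ≡ suc o
        Yi≡  = trans (lookup-update X i) (trans (cong₂ _+_ Xi≡o (one _ _ inv)) (+-comm o 1))

  -- Induction on the number `r` of iterations left, `o` being done. Passing `v` with an equation
  -- lets the recursive call shift `o` by one without transporting `Body`.
  loop-rule : ∀ r o → o + r ≡ M → {is os : Fin r → List ℕ} →
              (∀ k v → v ≡ o + toℕ k → Body (is k) (os k) v) →
              Triple (1 + r * (3 + T)) (AtHead o) (⨆ is) (loop i d m p) (⨆ os) (P M)
  loop-rule zero o eq ok s rest (inv , _ , Xd≡) in≡ =
    1 , s , run-stop (trans Xd≡ (trans (cong (M ∸_) o≡M) (n∸n≡0 M))) ,
    subst (λ k → P k (reg s)) o≡M inv , in≡ , ≡.sym (++-identityʳ _) , ≤-refl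
    where
    o≡M : o ≡ M
    o≡M = trans (≡.sym (+-identityʳ o)) eq
  loop-rule (suc r) o eq {is} {os} ok s rest (inv , Xi≡ , Xd≡) in≡
    with ⨾-rule (ok zero o (≡.sym (+-identityʳ o))) (advance o) s (⨆ (is ∘ suc) ++ rest) (inv , Xi≡)
           (trans in≡ (trans (++-assoc (is zero) _ rest) (cong (_++ ⨆ (is ∘ suc) ++ rest) (≡.sym (++-identityʳ (is zero))))))
  ... | t , s′ , run , inv′ , in′ , out′ , t≤
    with loop-rule r (suc o) (trans (≡.sym (+-suc o r)) eq)
           (λ k v v≡ → ok (suc k) v (trans v≡ (≡.sym (+-suc o (toℕ k))))) s′ rest inv′ in′
  ... | t′ , s″ , run′ , inv″ , in″ , out″ , t′≤ =
    _ , s″ , run-loop positive run run′ , inv″ , in″ ,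
    trans out″ (trans (cong (_++ ⨆ (os ∘ suc)) (trans out′ (cong (output s ++_) (++-identityʳ (os zero)))))
                      (++-assoc (output s) (os zero) _)) ,
    s≤s (≤-trans (+-mono-≤ t≤ t′≤) (≤-reflexive arith))
    where
    positive : 1 ≤ reg s d
    positive = ≤-trans (s≤s z≤n) (≤-reflexive (trans (≡.sym (m+n∸m≡n o (suc r))) (trans (cong (_∸ o) eq) (≡.sym Xd≡))))
    arith : T + 2 + (1 + r * (3 + T)) ≡ suc r * (3 + T)
    arith = trans (≡.sym (+-assoc (T + 2) 1 _))
                  (cong (_+ r * (3 + T)) (trans (+-assoc T 2 1) (+-comm T 3)))

  for-rule : {is os : Fin M → List ℕ} →
             (∀ k → Body (is k) (os k) (toℕ k)) →
             Triple (for-time M T) (P 0) (⨆ is) (for i d m p) (⨆ os) (P M)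
  for-rule ok =
    strengthen (λ X inv → start X (i-stable 0 X 0 inv))
        (⨾-rule const-rule (⨾-rule (sub-rule {Q = AtHead 0})
          (loop-rule M 0 refl (λ { k _ refl → ok k }))))
    where
    start : ∀ X → let Y = X [ i ↦ 0 ] in P 0 Y → AtHead 0 (Y [ d ↦ Y m ∸ Y i ])
    start X inv = d-stable _ _ _ inv , trans (lookup-other Y d i d≢i) (lookup-update X i) ,
      trans (lookup-update Y d) (cong₂ _∸_ (bound _ _ inv) (lookup-update X i))
      where Y = X [ i ↦ 0 ]

-- The graph H and its adjacency matrix

-- inj₁ (u , j) is the j-th vertex of the block of u, inj₂ u the copy of u itself.
Vertex : ℕ → Set
Vertex n = (Fin n × Fin (n ^ 2)) ⊎ Fin n

-- `n ^ 3` unfolds to `n * n ^ 2`, so `combine u j` has the required type without a cast.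
index : ∀ {n} → Vertex n → Fin (n ^ 3 + n)
index {n} (inj₁ (u , j)) = combine u j ↑ˡ n
index {n} (inj₂ u)       = n ^ 3 ↑ʳ u

vertex : ∀ {n} → Fin (n ^ 3 + n) → Vertex n
vertex {n} i = map₁ (remQuot (n ^ 2)) (splitAt (n ^ 3) i)

vertex-index : ∀ {n} (x : Vertex n) → vertex (index x) ≡ x
vertex-index {n} (inj₁ (u , j)) =
  trans (cong (map₁ (remQuot (n ^ 2))) (Fin.splitAt-↑ˡ (n ^ 3) (combine u j) n))
        (cong inj₁ (Fin.remQuot-combine u j))
vertex-index {n} (inj₂ u) = cong (map₁ (remQuot (n ^ 2))) (Fin.splitAt-↑ʳ (n ^ 3) n u)

same : ∀ {n} → Fin n → Fin n → Bool
same u v = does (u Fin.≟ v)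

same-sym : ∀ {n} (u v : Fin n) → same u v ≡ same v u
same-sym u v with u Fin.≟ v | v Fin.≟ u
... | yes _    | yes _  = refl
... | no _     | no _   = refl
... | yes refl | no v≢u with () ← v≢u refl
... | no u≢v   | yes refl with () ← u≢v refl

same-refl : ∀ {n} (u : Fin n) → same u u ≡ true
same-refl u = dec-true (u Fin.≟ u) refl

adjacent : ∀ {n} → Graph n → Vertex n → Vertex n → Bool
adjacent G (inj₁ (u , i)) (inj₁ (v , j)) = not (same u v ∧ same i j)
adjacent G (inj₁ (u , _)) (inj₂ v)       = not (same u v)
adjacent G (inj₂ u)       (inj₁ (v , _)) = not (same u v)
adjacent G (inj₂ u)       (inj₂ v)       = has (E G) u v

adjacent-sym : ∀ {n} (G : Graph n) x y → adjacent G x y ≡ adjacent G y x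
adjacent-sym G (inj₁ (u , i)) (inj₁ (v , j)) = cong not (cong₂ _∧_ (same-sym u v) (same-sym i j))
adjacent-sym G (inj₁ (u , _)) (inj₂ v)       = cong not (same-sym u v)
adjacent-sym G (inj₂ u)       (inj₁ (v , _)) = cong not (same-sym u v)
adjacent-sym G (inj₂ u)       (inj₂ v)       = sym (E G) u v

adjacent-irrefl : ∀ {n} (G : Graph n) x → adjacent G x x ≡ false
adjacent-irrefl G (inj₁ (u , i)) = cong not (cong₂ _∧_ (same-refl u) (same-refl i))
adjacent-irrefl G (inj₂ u)       = irrefl (E G) u

construct : ∀ n → Graph n → Graph (n ^ 3 + n)
construct n G = graph record
  { has    = λ i j → adjacent G (vertex i) (vertex j)
  ; sym    = λ i j → adjacent-sym G (vertex i) (vertex j)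
  ; irrefl = λ i → adjacent-irrefl G (vertex i)
  }

-- Row-major listing of adjacency matrices

⨆-cong : ∀ {a} {A : Set a} {n} {f g : Fin n → List A} → (∀ i → f i ≡ g i) → ⨆ f ≡ ⨆ g
⨆-cong f≗g = cong concat (tabulate-cong f≗g)

⨆-+ : ∀ {a} {A : Set a} m {n} (f : Fin (m + n) → List A) →
      ⨆ f ≡ ⨆ (λ i → f (i ↑ˡ n)) ++ ⨆ (λ j → f (m ↑ʳ j))
⨆-+ zero    f = refl
⨆-+ (suc m) f = trans (cong (f zero ++_) (⨆-+ m (f ∘ suc))) (≡.sym (++-assoc (f zero) _ _))

⨆-* : ∀ {a} {A : Set a} m {n} (f : Fin (m * n) → List A) →
      ⨆ f ≡ ⨆ λ i → ⨆ λ j → f (combine {m} {n} i j)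
⨆-* zero        f = refl
⨆-* (suc m) {n} f = trans (⨆-+ n f) (cong (⨆ (λ j → f (j ↑ˡ (m * n))) ++_) (⨆-* m (f ∘ (n ↑ʳ_))))

-- Turns a listing by index into the shape of the program's loops: a nest over the block vertices,
-- then a loop over the copies.
⨆-vertex : ∀ {a} {A : Set a} {n} (f : Vertex n → List A) →
           ⨆ (f ∘ vertex) ≡ (⨆ λ u → ⨆ λ j → f (inj₁ (u , j))) ++ ⨆ (λ u → f (inj₂ u))
⨆-vertex {n = n} f = trans (⨆-+ (n ^ 3) (f ∘ vertex)) (cong₂ _++_
  (trans (⨆-* n (λ i → f (vertex (i ↑ˡ n))))
         (⨆-cong λ u → ⨆-cong λ j → cong f (vertex-index (inj₁ (u , j)))))
  (⨆-cong λ u → cong f (vertex-index (inj₂ u))))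

⨆-singletons : ∀ {a} {A : Set a} {n} (f : Fin n → A) → ⨆ (λ i → [ f i ]) ≡ tabulate f
⨆-singletons {n = zero}  f = refl
⨆-singletons {n = suc n} f = cong (f zero ∷_) (⨆-singletons (f ∘ suc))

map-cartesianProduct : ∀ {A B C : Set} {m n} (h : A × B → C) (f : Fin m → A) (g : Fin n → B) →
  map h (cartesianProduct (tabulate f) (tabulate g)) ≡ ⨆ λ i → ⨆ λ j → [ h (f i , g j) ]
map-cartesianProduct {m = zero}  h f g = refl
map-cartesianProduct {m = suc m} h f g = trans (map-++ h (map (f zero ,_) (tabulate g)) _) (cong₂ _++_
  (trans (≡.sym (map-∘ (tabulate g)))
         (trans (map-tabulate g _) (≡.sym (⨆-singletons λ j → h (f zero , g j)))))
  (map-cartesianProduct h (f ∘ suc) g))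

encode-⨆ : ∀ {n} (G : Graph n) → encode G ≡ n ∷ ⨆ λ u → ⨆ λ v → [ bit (has (E G) u v) ]
encode-⨆ {n} G = cong (n ∷_) (map-cartesianProduct _ (λ u → u) (λ u → u))

length-cartesianProduct : ∀ {A B : Set} (xs : List A) (ys : List B) →
                          length (cartesianProduct xs ys) ≡ length xs * length ys
length-cartesianProduct []       ys = refl
length-cartesianProduct (x ∷ xs) ys = trans (length-++ (map (x ,_) ys))
  (cong₂ _+_ (length-map (x ,_) ys) (length-cartesianProduct xs ys))

length-encode : ∀ {n} (G : Graph n) → length (encode G) ≡ suc (n * n)
length-encode {n} G = cong suc (trans (length-map _ (cartesianProduct (allFin n) (allFin n)))
  (trans (length-cartesianProduct (allFin n) (allFin n)) (cong₂ _*_ (length-tabulate {n = n} (λ u → u)) (length-tabulate {n = n} (λ u → u)))))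

-- At least one of the truncated differences is 0, so this is the absolute difference, computable
-- with `add` and `sub` alone.
distance : ℕ → ℕ → ℕ
distance a b = (a ∸ b) + (b ∸ a)

sign : ℕ → ℕ
sign x = 1 ∸ (1 ∸ x)

distance-zero : ∀ a → distance a a ≡ 0
distance-zero a = cong₂ _+_ (n∸n≡0 a) (n∸n≡0 a)

distance-pos : ∀ {a b} → a ≢ b → 1 ≤ distance a b
distance-pos {a} {b} a≢b with ≤-total a b
... | inj₁ a≤b = ≤-trans (m<n⇒0<n∸m (≤∧≢⇒< a≤b a≢b)) (m≤n+m _ (a ∸ b))
... | inj₂ b≤a = ≤-trans (m<n⇒0<n∸m (≤∧≢⇒< b≤a (a≢b ∘ ≡.sym))) (m≤m+n _ (b ∸ a))

sign-pos : ∀ {x} → 1 ≤ x → sign x ≡ 1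
sign-pos 1≤x = cong (1 ∸_) (m≤n⇒m∸n≡0 1≤x)

bit-differ : ∀ {n} (u v : Fin n) → bit (not (same u v)) ≡ sign (distance (toℕ u) (toℕ v))
bit-differ u v with u Fin.≟ v
... | yes refl = cong sign (≡.sym (distance-zero (toℕ u)))
... | no  u≢v  = ≡.sym (sign-pos (distance-pos (u≢v ∘ Fin.toℕ-injective)))

-- The sum of the distances vanishes exactly when both coordinates agree, so a single sign decides
-- equality of pairs.
bit-differ₂ : ∀ {m n} (u v : Fin m) (i j : Fin n) →
  bit (not (same u v ∧ same i j)) ≡
  sign (distance (toℕ u) (toℕ v) + distance (toℕ i) (toℕ j))
bit-differ₂ u v i j with u Fin.≟ v
... | yes refl = trans (bit-differ i j)
  (cong (λ x → sign (x + distance (toℕ i) (toℕ j))) (≡.sym (distance-zero (toℕ u))))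
... | no  u≢v  = ≡.sym (sign-pos (≤-trans (distance-pos (u≢v ∘ Fin.toℕ-injective)) (m≤m+n _ _)))

-- A program printing H

-- X₀ = n, X₁ = 1 and X₂ = n ^ 2 throughout; X₄, X₆, X₈, X₁₀ are loop counters.

-- X₁₂ is the accumulator and X₁₃ is scratch, in this and in all the printing code.
add-distance : (a b : ℕ) → Program
add-distance a b =
  instr (sub 13 a b) ⨾ instr (add 12 12 13) ⨾ instr (sub 13 b a) ⨾ instr (add 12 12 13)

print-sign : Program
print-sign = instr (sub 12 1 12) ⨾ instr (sub 12 1 12) ⨾ instr (print 12)

block-block : Program
block-block =
  instr (const 12 0) ⨾ add-distance 4 8 ⨾ add-distance 6 10 ⨾ print-sign

block-copy : Program
block-copy = instr (const 12 0) ⨾ add-distance 4 8 ⨾ print-sign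

copy-copy : Program
copy-copy = instr (read 12) ⨾ instr (print 12)

block-rows : Program
block-rows = for 4 5 0 (for 6 7 2 (for 8 9 0 (for 10 11 2 block-block) ⨾ for 8 9 0 block-copy))

copy-rows : Program
copy-rows = for 4 5 0 (for 8 9 0 (for 10 11 2 block-copy) ⨾ for 8 9 0 copy-copy)

-- In the absence of multiplication, `n ^ 2` is a sum of `n` copies of `n`. Likewise `print-order`
-- adds `n ^ 2` to `n` in each of `n` rounds.
square : Program
square = instr (const 2 0) ⨾ for 4 5 0 (instr (add 2 2 0))

print-order : Program
print-order = instr (const 3 0) ⨾ instr (add 3 3 0) ⨾ for 4 5 0 (instr (add 3 3 2)) ⨾ instr (print 3)

program : Program
program = instr (read 0) ⨾ instr (const 1 1) ⨾ square ⨾ print-order ⨾ block-rows ⨾ copy-rows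

Globals : ℕ → Assertion
Globals n X = X 0 ≡ n × X 1 ≡ 1 × X 2 ≡ n ^ 2

-- Straight-line code determines its final state, so unification fills it in.
run-distance : ∀ {a b s} → Run (add-distance a b) s 4 _
run-distance = run-⨾ run-instr (run-⨾ run-instr (run-⨾ run-instr run-instr))

run-sign : ∀ {s} → Run print-sign s 3 _
run-sign = run-⨾ run-instr (run-⨾ run-instr run-instr)

⨆-empty : ∀ {a} {A : Set a} n → ⨆_ {A = A} {n} (λ _ → []) ≡ []
⨆-empty zero    = refl
⨆-empty (suc n) = ⨆-empty n

-- The case of `for-rule` with a constant invariant and an empty input slice in every iteration;
-- `⨆-empty` collapses these slices to `[]`.
for-emit : ∀ {i d m M T p} {os : Fin M → List ℕ} (P : Assertion) →
  Stable P i → Stable P d → (d ≡ᵇ i) ≡ false →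
  (∀ X → P X → X 1 ≡ 1) → (∀ X → P X → X m ≡ M) →
  (∀ k → let Q = λ X → P X × X i ≡ toℕ k in Triple T Q [] p (os k) Q) →
  Triple (for-time M T) P [] (for i d m p) (⨆ os) P
for-emit {i} {d} {m} {M} {T} {p} {os} P i-st d-st d≢i one bound ok =
  subst (λ is → Triple (for-time M T) P is (for i d m p) (⨆ os) P) (⨆-empty M)
    (for-rule (λ _ → P) (λ _ → i-st) (λ _ → d-st) d≢i (λ _ → one) (λ _ → bound) ok)

for-silent : ∀ {i d m M T p} (P : ℕ → Assertion) →
  (∀ k → Stable (P k) i) → (∀ k → Stable (P k) d) → (d ≡ᵇ i) ≡ false →
  (∀ k X → P k X → X 1 ≡ 1) → (∀ k X → P k X → X m ≡ M) →
  (∀ k → Triple T (λ X → P k X × X i ≡ k) [] p [] (λ X → P (suc k) X × X i ≡ k)) →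
  Triple (for-time M T) (P 0) [] (for i d m p) [] (P M)
for-silent {i} {d} {m} {M} {T} {p} P i-st d-st d≢i one bound ok =
  ≡.subst₂ (λ is os → Triple (for-time M T) (P 0) is (for i d m p) os (P M)) (⨆-empty M) (⨆-empty M)
    (for-rule P i-st d-st d≢i one bound (λ k → ok (toℕ k)))

block-rows-time : ℕ → ℕ
block-rows-time n = for-time n (for-time (n ^ 2)
  (for-time n (for-time (n ^ 2) 12) + for-time n 8))

copy-rows-time : ℕ → ℕ
copy-rows-time n = for-time n (for-time n (for-time (n ^ 2) 8) + for-time n 2)

program-time : ℕ → ℕ
program-time n = 2 + ((1 + for-time n 1) + ((2 + (for-time n 1 + 1)) + (block-rows-time n + copy-rows-time n)))

module _ {n : ℕ} where

  -- The left side is the final content of X₁₂, associated as the four additions build it up from 0.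
  print-differ₂ : ∀ {o a b c d} (u v : Fin n) (i j : Fin (n ^ 2)) →
    o ≡ 1 → a ≡ toℕ u → b ≡ toℕ v → c ≡ toℕ i → d ≡ toℕ j →
    o ∸ (o ∸ (distance a b + (c ∸ d) + (d ∸ c))) ≡ bit (not (same u v ∧ same i j))
  print-differ₂ u v i j refl refl refl refl refl = trans
    (cong sign (+-assoc (distance (toℕ u) (toℕ v)) (toℕ i ∸ toℕ j) (toℕ j ∸ toℕ i)))
    (≡.sym (bit-differ₂ u v i j))

  print-differ : ∀ {o a b} (u v : Fin n) → o ≡ 1 → a ≡ toℕ u → b ≡ toℕ v →
    o ∸ (o ∸ distance a b) ≡ bit (not (same u v))
  print-differ u v refl refl refl = ≡.sym (bit-differ u v)

  block-block-rule : ∀ (u : Fin n) (i : Fin (n ^ 2)) (v : Fin n) (j : Fin (n ^ 2)) →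
    let P : Assertion
        P X = (((Globals n X × X 4 ≡ toℕ u) × X 6 ≡ toℕ i) × X 8 ≡ toℕ v) × X 10 ≡ toℕ j
    in Triple 12 P [] block-block [ bit (not (same u v ∧ same i j)) ] P
  block-block-rule u i v j s rest P@(((((_ , X₁ , _) , X₄) , X₆) , X₈) , X₁₀) in≡ =
    12 , _ ,
    run-⨾ run-instr (run-⨾ run-distance (run-⨾ run-distance run-sign)) ,
    -- The proof of the precondition serves again: all writes go to X₁₂ and X₁₃, which it does not
    -- mention.
    P , in≡ , cong (λ x → output s ++ [ x ]) (print-differ₂ u v i j X₁ X₄ X₈ X₆ X₁₀) , ≤-refl

  -- `P` is kept abstract because this code runs inside two different loop nests.
  block-copy-rule : ∀ (u v : Fin n) {P : Assertion} → Stable P 12 → Stable P 13 →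
    (∀ X → P X → X 1 ≡ 1 × X 4 ≡ toℕ u × X 8 ≡ toℕ v) →
    Triple 8 P [] block-copy [ bit (not (same u v)) ] P
  block-copy-rule u v st₁₂ st₁₃ values s rest P in≡ with values (reg s) P
  ... | X₁ , X₄ , X₈ =
    8 , _ , run-⨾ run-instr (run-⨾ run-distance run-sign) ,
    -- One stability step for each of the seven register writes, the last write outermost.
    st₁₂ _ _ (st₁₂ _ _ (st₁₂ _ _ (st₁₃ _ _ (st₁₂ _ _ (st₁₃ _ _ (st₁₂ _ _ P)))))) ,
    in≡ , cong (λ x → output s ++ [ x ]) (print-differ u v X₁ X₄ X₈) , ≤-refl

  block-row : (u : Fin n) (i : Fin (n ^ 2)) → List ℕ
  block-row u i = (⨆ λ v → ⨆ λ j → [ bit (not (same u v ∧ same i j)) ])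
               ++ ⨆ λ v → [ bit (not (same u v)) ]

  block-rows-rule : Triple (block-rows-time n) (Globals n) [] block-rows
                      (⨆ λ u → ⨆ λ i → block-row u i) (Globals n)
  block-rows-rule =
    for-emit (Globals n)
      (λ _ _ P → P) (λ _ _ P → P) refl (λ { _ (_ , X₁ , _) → X₁ }) (λ { _ (X₀ , _) → X₀ }) λ u →
    for-emit (λ X → Globals n X × X 4 ≡ toℕ u)
      (λ _ _ P → P) (λ _ _ P → P) refl (λ { _ ((_ , X₁ , _) , _) → X₁ }) (λ { _ ((_ , _ , X₂) , _) → X₂ }) λ i →
    ⨾-rule
      (for-emit (λ X → (Globals n X × X 4 ≡ toℕ u) × X 6 ≡ toℕ i)
        (λ _ _ P → P) (λ _ _ P → P) refl
        (λ { _ (((_ , X₁ , _) , _) , _) → X₁ }) (λ { _ (((X₀ , _) , _) , _) → X₀ }) λ v →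
      for-emit (λ X → ((Globals n X × X 4 ≡ toℕ u) × X 6 ≡ toℕ i) × X 8 ≡ toℕ v)
        (λ _ _ P → P) (λ _ _ P → P) refl
        (λ { _ ((((_ , X₁ , _) , _) , _) , _) → X₁ }) (λ { _ ((((_ , _ , X₂) , _) , _) , _) → X₂ }) λ j →
      block-block-rule u i v j)
      (for-emit (λ X → (Globals n X × X 4 ≡ toℕ u) × X 6 ≡ toℕ i)
        (λ _ _ P → P) (λ _ _ P → P) refl
        (λ { _ (((_ , X₁ , _) , _) , _) → X₁ }) (λ { _ (((X₀ , _) , _) , _) → X₀ }) λ v →
      block-copy-rule u v (λ _ _ P → P) (λ _ _ P → P)
        (λ { _ ((((_ , X₁ , _) , X₄) , _) , X₈) → X₁ , X₄ , X₈ }))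

  copy-row : Graph n → Fin n → List ℕ
  copy-row G u = (⨆ λ v → ⨆ λ (_ : Fin (n ^ 2)) → [ bit (not (same u v)) ])
              ++ ⨆ λ v → [ bit (has (E G) u v) ]

  copy-rows-rule : (G : Graph n) →
    Triple (copy-rows-time n) (Globals n)
      (⨆ λ u → ⨆ λ v → [ bit (has (E G) u v) ]) copy-rows (⨆ λ u → copy-row G u) (Globals n)
  copy-rows-rule G =
    -- `for-rule` instead of `for-emit`: iteration `u` consumes row `u` of the input matrix, all of
    -- it in the second inner loop.
    for-rule (λ _ → Globals n)
      (λ _ _ _ P → P) (λ _ _ _ P → P) refl (λ { _ _ (_ , X₁ , _) → X₁ }) (λ { _ _ (X₀ , _) → X₀ }) λ u →
    ⨾-rule
      (for-emit (λ X → Globals n X × X 4 ≡ toℕ u)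
        (λ _ _ P → P) (λ _ _ P → P) refl
        (λ { _ ((_ , X₁ , _) , _) → X₁ }) (λ { _ ((X₀ , _) , _) → X₀ }) λ v →
      for-emit (λ X → (Globals n X × X 4 ≡ toℕ u) × X 8 ≡ toℕ v)
        (λ _ _ P → P) (λ _ _ P → P) refl
        (λ { _ (((_ , X₁ , _) , _) , _) → X₁ }) (λ { _ (((_ , _ , X₂) , _) , _) → X₂ }) λ j →
      block-copy-rule u v (λ _ _ P → P) (λ _ _ P → P)
        (λ { _ ((((_ , X₁ , _) , X₄) , X₈) , _) → X₁ , X₄ , X₈ }))
      (for-rule (λ _ X → Globals n X × X 4 ≡ toℕ u)
        (λ _ _ _ P → P) (λ _ _ _ P → P) refl
        (λ { _ _ ((_ , X₁ , _) , _) → X₁ }) (λ { _ _ ((X₀ , _) , _) → X₀ }) λ v →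
      copy-copy-rule u v)
    where
    copy-copy-rule : ∀ u v → let P = λ X → (Globals n X × X 4 ≡ toℕ u) × X 8 ≡ toℕ v in
                     Triple 2 P [ bit (has (E G) u v) ] copy-copy [ bit (has (E G) u v) ] P
    copy-copy-rule u v = consequence (λ _ P → P , refl) (λ _ → proj₁)
      (⨾-rule read-rule (print-rule {P = λ X → ((Globals n X × X 4 ≡ toℕ u) × X 8 ≡ toℕ v) × X 12 ≡ bit (has (E G) u v)} (λ _ → proj₂)))

  square-rule : Triple (1 + for-time n 1) (λ X → X 0 ≡ n × X 1 ≡ 1) [] square [] (Globals n)
  square-rule = consequence (λ { _ (X₀ , X₁) → X₀ , X₁ , refl })
    (λ { _ (X₀ , X₁ , X₂) → X₀ , X₁ , trans X₂ (cong (n *_) (≡.sym (*-identityʳ n))) })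
    (⨾-rule (const-rule {Q = P 0}) (for-silent P (λ _ _ _ P → P) (λ _ _ _ P → P) refl
      (λ { _ _ (_ , X₁ , _) → X₁ }) (λ { _ _ (X₀ , _) → X₀ }) λ k →
      strengthen (λ { _ ((X₀ , X₁ , X₂) , X₄) → (X₀ , X₁ , trans (cong₂ _+_ X₂ X₀) (+-comm (k * n) n)) , X₄ })
          (add-rule {Q = λ X → P (suc k) X × X 4 ≡ k})))
    where
    P : ℕ → Assertion
    P k X = X 0 ≡ n × X 1 ≡ 1 × X 2 ≡ k * n

  print-order-rule : Triple (2 + (for-time n 1 + 1)) (Globals n) [] print-order [ n ^ 3 + n ] (Globals n)
  print-order-rule = consequence (λ { _ G@(X₀ , _) → G , trans X₀ (≡.sym (+-identityʳ n)) }) (λ _ → proj₁)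
    (⨾-rule const-rule (⨾-rule (add-rule {Q = P 0}) (⨾-rule
      (for-silent P (λ _ _ _ P → P) (λ _ _ _ P → P) refl
        (λ { _ _ ((_ , X₁ , _) , _) → X₁ }) (λ { _ _ ((X₀ , _) , _) → X₀ }) λ k →
        strengthen (λ { _ ((G@(_ , _ , X₂) , X₃) , X₄) → (G , trans (cong₂ _+_ X₃ X₂) (step k)) , X₄ })
            (add-rule {Q = λ X → P (suc k) X × X 4 ≡ k}))
      (print-rule (λ { _ (_ , X₃) → trans X₃ (+-comm n (n ^ 3)) })))))
    where
    P : ℕ → Assertion
    P k X = Globals n X × X 3 ≡ n + k * n ^ 2
    step : ∀ k → n + k * n ^ 2 + n ^ 2 ≡ n + suc k * n ^ 2
    step k = trans (+-assoc n _ _) (cong (n +_) (+-comm (k * n ^ 2) (n ^ 2)))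

  program-rule : (G : Graph n) →
    Triple (program-time n)
      (λ _ → ⊤) (n ∷ ⨆ λ u → ⨆ λ v → [ bit (has (E G) u v) ]) program
      (n ^ 3 + n ∷ (⨆ λ u → ⨆ λ i → block-row u i) ++ ⨆ λ u → copy-row G u) (Globals n)
  program-rule G = strengthen (λ _ _ → refl , refl)
    (⨾-rule read-rule (⨾-rule const-rule (⨾-rule square-rule (⨾-rule print-order-rule
      (⨾-rule block-rows-rule (copy-rows-rule G))))))

  encode-construct : (G : Graph n) → encode (construct n G) ≡
    n ^ 3 + n ∷ (⨆ λ u → ⨆ λ i → block-row u i) ++ ⨆ λ u → copy-row G u
  encode-construct G = trans (encode-⨆ (construct n G)) (cong (n ^ 3 + n ∷_)
    -- The first use of `⨆-vertex` splits the columns within each row, the second splits the rows.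
    (trans (⨆-cong λ i → ⨆-vertex (λ y → [ bit (adjacent G (vertex i) y) ]))
           (⨆-vertex λ x → (⨆ λ v → ⨆ λ j → [ bit (adjacent G x (inj₁ (v , j))) ])
                         ++ ⨆ λ v → [ bit (adjacent G x (inj₂ v)) ])))

-- Polynomial bounds on the running time

PolyBounded : (ℕ → ℕ) → Set
PolyBounded f = ∃[ a ] ∃[ k ] ∀ n → f n ≤ a * suc n ^ k

^-bound : ∀ n k l → suc n ^ k ≤ suc n ^ (k + l)
^-bound n k l = ^-monoʳ-≤ (suc n) (m≤m+n k l)

poly-const : ∀ c → PolyBounded (λ _ → c)
poly-const c = c , 0 , λ _ → ≤-reflexive (≡.sym (*-identityʳ c))

poly-id : PolyBounded (λ n → n)
poly-id = 1 , 1 , λ n → ≤-trans (n≤1+n n) (≤-reflexive (≡.sym (trans (*-identityˡ _) (*-identityʳ (suc n)))))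

-- The base `suc n` is at least 1, also for `n` zero, so both powers lie below the one with exponent
-- `k + l`, and a single monomial suffices.
poly-+ : ∀ {f g} → PolyBounded f → PolyBounded g → PolyBounded (λ n → f n + g n)
poly-+ (a , k , f≤) (b , l , g≤) = a + b , k + l , λ n → ≤-trans
  (+-mono-≤ (≤-trans (f≤ n) (*-monoʳ-≤ a (^-bound n k l)))
            (≤-trans (g≤ n) (*-monoʳ-≤ b (≤-trans (^-bound n l k) (≤-reflexive (cong (suc n ^_) (+-comm l k)))))))
  (≤-reflexive (≡.sym (*-distribʳ-+ (suc n ^ (k + l)) a b)))

poly-* : ∀ {f g} → PolyBounded f → PolyBounded g → PolyBounded (λ n → f n * g n)
poly-* (a , k , f≤) (b , l , g≤) = a * b , k + l , λ n → ≤-trans (*-mono-≤ (f≤ n) (g≤ n))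
  (≤-reflexive (trans ([m*n]*[o*p]≡[m*o]*[n*p] a (suc n ^ k) b (suc n ^ l))
                      (cong (a * b *_) (≡.sym (^-distribˡ-+-* (suc n) k l)))))

poly-for : ∀ {r T} → PolyBounded r → PolyBounded T → PolyBounded (λ n → for-time (r n) (T n))
poly-for r T = poly-+ (poly-const 3) (poly-* r (poly-+ (poly-const 3) T))

program-time-bounded : PolyBounded program-time
program-time-bounded =
  poly-+ (poly-const 2) (poly-+ (poly-+ (poly-const 1) (poly-for poly-id (poly-const 1)))
    (poly-+ (poly-+ (poly-const 2) (poly-+ (poly-for poly-id (poly-const 1)) (poly-const 1)))
      (poly-+
        (poly-for poly-id (poly-for poly-square
          (poly-+ (poly-for poly-id (poly-for poly-square (poly-const 12)))
                  (poly-for poly-id (poly-const 8)))))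
        (poly-for poly-id
          (poly-+ (poly-for poly-id (poly-for poly-square (poly-const 8)))
                  (poly-for poly-id (poly-const 2)))))))
  where
  poly-square : PolyBounded (_^ 2)
  poly-square = poly-* poly-id (poly-* poly-id (poly-const 1))

construct-polynomial : PolynomialTime construct
construct-polynomial = program , a , 0 , k , λ n G →
  let t , s , run , _ , _ , out , t≤ =
        program-rule G (initial (encode G)) [] _ (trans (encode-⨆ G) (≡.sym (++-identityʳ _)))
  in t , s , run , trans out (≡.sym (encode-construct G)) , (begin
    t                             ≤⟨ t≤ ⟩
    program-time n                ≤⟨ bounded n ⟩
    -- As `n ≤ n * n`, the base `suc n` is at most the input length `suc (n * n)`.
    a * suc n ^ k                 ≤⟨ *-monoʳ-≤ a (^-monoˡ-≤ k (s≤s (n≤n*n n))) ⟩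
    a * suc (n * n) ^ k           ≡⟨ cong (λ ℓ → a * ℓ ^ k) (length-encode G) ⟨
    a * length (encode G) ^ k     ≡⟨ +-identityʳ _ ⟨
    a * length (encode G) ^ k + 0 ∎)
  where
  open ≤-Reasoning
  a = proj₁ program-time-bounded
  k = proj₁ (proj₂ program-time-bounded)
  bounded = proj₂ (proj₂ program-time-bounded)
  n≤n*n : ∀ n → n ≤ n * n
  n≤n*n zero    = z≤n
  n≤n*n (suc n) = m≤m*n (suc n) (suc n)

-- Split graphs and counting

-- On an induced cycle, two non-consecutive vertices cannot both lie in the clique, and two
-- consecutive ones cannot both lie in the independent set. From length four on, these constraints
-- are contradictory.
split-chordal : ∀ {n} (G : Graph n) {Core : Fin n → Set} → (∀ v → Dec (Core v)) →
  (∀ {u v} → Core u → Core v → u ≢ v → Adj G u v) →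
  (∀ {u v} → ¬ Core u → ¬ Core v → ¬ Adj G u v) →
  Chordal G
split-chordal {n} G {Core} core? clique independent = no-cycle
  where
  module _ {k : ℕ} .{{_ : NonZero k}} (C : InducedCycle G k) where

    f     = proj₁ C
    f-inj = proj₁ (proj₂ C)
    cycle = proj₂ (proj₂ C)

    apart : ∀ {i j} → i ≢ j → ¬ Next i j → ¬ Next j i → Core (f i) → ¬ Core (f j)
    apart i≢j ¬ij ¬ji ci cj =
      [ ¬ij , ¬ji ]′ (to (cycle _ _) (clique ci cj (i≢j ∘ f-inj)))

    cover : ∀ {i j} → Next i j → ¬ Core (f i) → Core (f j)
    cover {i} {j} ij ¬ci with core? (f j)
    ... | yes cj = cj
    ... | no ¬cj = ⊥-elim (independent ¬ci ¬cj (from (cycle i j) (inj₁ ij)))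

    -- On a path a b c d the core is exactly {b , c}; shifting the path by
    -- one along the cycle contradicts this.
    path-core : ∀ {a b c d e} → Next a b → Next b c → Next c d → Next d e →
      (Core (f a) → ¬ Core (f c)) → (Core (f b) → ¬ Core (f d)) → (Core (f c) → ¬ Core (f e)) → ⊥
    path-core {a} {b} {c} {d} ab bc cd de ac bd ce with core? (f b) | core? (f c)
    ... | yes cb | yes cc = ce cc (cover de (bd cb))
    ... | yes cb | no ¬cc = bd cb (cover cd ¬cc)
    ... | no ¬cb | no ¬cc = ¬cc (cover bc ¬cb)
    ... | no ¬cb | yes cc with core? (f a)
    ...   | yes ca = ac ca cc
    ...   | no ¬ca = ¬cb (cover ab ¬ca)

  no-cycle : Chordal G
  -- On a cycle of length 4 the fifth vertex of the walk is the first again. Length 5 is separate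
  -- from the longer ones because the successor of `4F` wraps to 0 there; in each clause `Next` then
  -- computes.
  no-cycle 4 4≤k C = path-core C {0F} {1F} {2F} {3F} {0F}
    refl refl refl refl
    (apart C (λ ()) (λ ()) (λ ())) (apart C (λ ()) (λ ()) (λ ())) (apart C (λ ()) (λ ()) (λ ()))
  no-cycle 5 4≤k C = path-core C {0F} {1F} {2F} {3F} {4F}
    refl refl refl refl
    (apart C (λ ()) (λ ()) (λ ())) (apart C (λ ()) (λ ()) (λ ())) (apart C (λ ()) (λ ()) (λ ()))
  no-cycle (suc (suc (suc (suc (suc (suc k)))))) 4≤k C = path-core C {0F} {1F} {2F} {3F} {4F}
    refl refl refl refl
    (apart C (λ ()) (λ ()) (λ ())) (apart C (λ ()) (λ ()) (λ ())) (apart C (λ ()) (λ ()) (λ ()))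
  no-cycle 1 (s≤s ()) C
  no-cycle 2 (s≤s (s≤s ())) C
  no-cycle 3 (s≤s (s≤s (s≤s ()))) C

-- Delete the head of `xs` from `ys` at an occurrence: by uniqueness the tail of `xs` still embeds
-- in what is left. Both bounds on the number of fill edges are derived from this.
unique-⊆-length : ∀ {A : Set} {xs ys : List A} → Unique xs → (∀ {x} → x List.∈ xs → x List.∈ ys) →
                  length xs ≤ length ys
unique-⊆-length {xs = []} [] xs⊆ys = z≤n
unique-⊆-length {xs = x ∷ xs} (x∉xs ∷ u) xs⊆ys with ∈-∃++ (xs⊆ys (here refl))
... | as , bs , refl = ≤-trans (s≤s (unique-⊆-length u avoid)) (≤-reflexive lengths)
  where
  avoid : ∀ {y} → y List.∈ xs → y List.∈ as ++ bs
  avoid y∈xs with ∈-++⁻ as (xs⊆ys (there y∈xs))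
  ... | inj₁ y∈as           = ∈-++⁺ˡ y∈as
  ... | inj₂ (there y∈bs)   = ∈-++⁺ʳ as y∈bs
  ... | inj₂ (here refl)    = ⊥-elim (All.lookup x∉xs y∈xs refl)
  lengths : suc (length (as ++ bs)) ≡ length (as ++ x ∷ bs)
  lengths = trans (cong suc (length-++ as)) (trans (≡.sym (+-suc (length as) (length bs))) (≡.sym (length-++ as)))

elements : ∀ {n} → Subset n → List (Fin n)
elements []            = []
elements (inside ∷ S)  = zero ∷ map suc (elements S)
elements (outside ∷ S) = map suc (elements S)

length-elements : ∀ {n} (S : Subset n) → length (elements S) ≡ ∣ S ∣
length-elements []            = refl
length-elements (inside ∷ S)  = cong suc (trans (length-map suc (elements S)) (length-elements S))
length-elements (outside ∷ S) = trans (length-map suc (elements S)) (length-elements S)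

∈-elements⁺ : ∀ {n} {S : Subset n} {u} → u ∈ S → u List.∈ elements S
∈-elements⁺ {S = inside ∷ S}  here        = here refl
∈-elements⁺ {S = inside ∷ S}  (there u∈S) = there (∈-map⁺ suc (∈-elements⁺ u∈S))
∈-elements⁺ {S = outside ∷ S} (there u∈S) = ∈-map⁺ suc (∈-elements⁺ u∈S)

∈-elements⁻ : ∀ {n} (S : Subset n) {u} → u List.∈ elements S → u ∈ S
∈-elements⁻ (inside ∷ S)  (here refl) = here
∈-elements⁻ (inside ∷ S)  (there u∈) with ∈-map⁻ suc u∈
... | _ , v∈ , refl = there (∈-elements⁻ S v∈)
∈-elements⁻ (outside ∷ S) u∈ with ∈-map⁻ suc u∈
... | _ , v∈ , refl = there (∈-elements⁻ S v∈)

elements-unique : ∀ {n} (S : Subset n) → Unique (elements S)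
elements-unique []            = []
elements-unique (inside ∷ S)  =
  All.tabulate (λ u∈ 0≡u → case ∈-map⁻ suc u∈ of λ { (_ , _ , refl) → case 0≡u of λ () })
  ∷ Unique.map⁺ Fin.suc-injective (elements-unique S)
elements-unique (outside ∷ S) = Unique.map⁺ Fin.suc-injective (elements-unique S)

-- Bridges the gap between a cover of size at most `c`, which a fill-in yields, and one of size
-- exactly `c`; supersets of covers are covers.
enlarge : ∀ {n} (S : Subset n) {c} → ∣ S ∣ ≤ c → c ≤ n → ∃[ S′ ] (S ⊆ S′ × ∣ S′ ∣ ≡ c)
enlarge []            S≤c       z≤n       = [] , (λ u∈S → u∈S) , refl
enlarge (inside ∷ S)  (s≤s S≤c) (s≤s c≤n) with enlarge S S≤c c≤n
... | S′ , S⊆S′ , eq = inside ∷ S′ , (λ { here → here ; (there u∈) → there (S⊆S′ u∈) }) , cong suc eq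
enlarge {suc n} (outside ∷ S) {c} S≤c c≤1+n with c ≤? n
... | yes c≤n with enlarge S S≤c c≤n
...   | S′ , S⊆S′ , eq = outside ∷ S′ , (λ { (there u∈) → there (S⊆S′ u∈) }) , eq
-- Here `c` equals `suc n`, so every element has to be taken.
enlarge {suc n} (outside ∷ S) {c} S≤c c≤1+n | no c≰n with enlarge S (∣p∣≤n S) ≤-refl
...   | S′ , S⊆S′ , eq =
  inside ∷ S′ , (λ { (there u∈) → there (S⊆S′ u∈) }) , trans (cong suc eq) (≤-antisym (≰⇒> c≰n) c≤1+n)

-- The block vertex comes first because its index is the smaller one, which is the orientation kept
-- by `edgeList`. The list bounds a fill-in from below in one direction and from above in the other.
blockEdges : ∀ {n} → Subset n → List (Fin (n ^ 3 + n) × Fin (n ^ 3 + n))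
blockEdges {n} S = map (λ (u , j) → index (inj₁ (u , j)) , index {n} (inj₂ u))
                       (cartesianProduct (elements S) (allFin (n ^ 2)))

length-blockEdges : ∀ {n} (S : Subset n) → length (blockEdges S) ≡ ∣ S ∣ * n ^ 2
length-blockEdges {n} S = trans (length-map _ (cartesianProduct (elements S) (allFin (n ^ 2))))
  (trans (length-cartesianProduct (elements S) (allFin (n ^ 2)))
         (cong₂ _*_ (length-elements S) (length-tabulate {n = n ^ 2} (λ j → j))))

index-injective : ∀ {n} {x y : Vertex n} → index x ≡ index y → x ≡ y
index-injective {x = x} {y} eq = trans (≡.sym (vertex-index x)) (trans (cong vertex eq) (vertex-index y))

index-vertex : ∀ {n} (i : Fin (n ^ 3 + n)) → index {n} (vertex i) ≡ i
index-vertex {n} i with splitAt (n ^ 3) i in eq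
... | inj₁ w = trans (cong (_↑ˡ n) (Fin.combine-remQuot {n} (n ^ 2) w)) (Fin.splitAt⁻¹-↑ˡ eq)
... | inj₂ u = Fin.splitAt⁻¹-↑ʳ eq

blockEdges-unique : ∀ {n} (S : Subset n) → Unique (blockEdges S)
blockEdges-unique {n} S = Unique.map⁺ (λ eq → inj₁-inj (index-injective (cong proj₁ eq)))
  (Unique.cartesianProduct⁺ (elements-unique S) (Unique.allFin⁺ (n ^ 2)))
  where
  inj₁-inj : ∀ {A B : Set} {x y : A} → inj₁ {B = B} x ≡ inj₁ y → x ≡ y
  inj₁-inj refl = refl

block<copy : ∀ {n} (p : Fin n × Fin (n ^ 2)) (v : Fin n) → toℕ (index (inj₁ p)) < toℕ (index {n} (inj₂ v))
block<copy {n} (u , j) v = ≤-trans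
  (≤-trans (s≤s (≤-reflexive (Fin.toℕ-↑ˡ (combine u j) n))) (Fin.toℕ<n (combine u j)))
  (≤-trans (m≤m+n (n ^ 3) (toℕ v)) (≤-reflexive (≡.sym (Fin.toℕ-↑ʳ (n ^ 3) v))))

∈-edgeList⁺ : ∀ {n} (F : EdgeSet n) {u v} → toℕ u < toℕ v → T (has F u v) → (u , v) List.∈ edgeList F
∈-edgeList⁺ F {u} {v} u<v uv = ∈-filter⁺ _ (∈-cartesianProduct⁺ (∈-allFin u) (∈-allFin v)) (u<v , uv)

∈-edgeList⁻ : ∀ {n} (F : EdgeSet n) {u v} → (u , v) List.∈ edgeList F → toℕ u < toℕ v × T (has F u v)
∈-edgeList⁻ {n} F uv∈ = proj₂ (∈-filter⁻ _ {xs = cartesianProduct (allFin n) (allFin n)} uv∈)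

edgeList-unique : ∀ {n} (F : EdgeSet n) → Unique (edgeList F)
edgeList-unique {n} F = Unique.filter⁺ _ (Unique.cartesianProduct⁺ (Unique.allFin⁺ n) (Unique.allFin⁺ n))

-- Vertex covers and fill-ins

Adj-sym : ∀ {n} (G : Graph n) {u v} → Adj G u v → Adj G v u
Adj-sym G {u} {v} = subst T (sym (E G) u v)

Adj-irrefl : ∀ {n} (G : Graph n) {v} → ¬ Adj G v v
Adj-irrefl G {v} = subst T (irrefl (E G) v)

four-cycle : ∀ {n} (G : Graph n) {w x y z} →
  Adj G w x → Adj G x y → Adj G y z → Adj G z w →
  w ≢ y → x ≢ z → ¬ Adj G w y → ¬ Adj G x z → InducedCycle G 4
four-cycle G {w} {x} {y} {z} wx xy yz zw w≢y x≢z ¬wy ¬xz = f , f-injective _ _ , λ i j → mk⇔ (⇒ i j) (⇐ i j)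
  where
  f : Fin 4 → Fin _
  f 0F = w
  f 1F = x
  f 2F = y
  f 3F = z

  ⇒ : ∀ i j → Adj G (f i) (f j) → Next i j ⊎ Next j i
  ⇒ 0F 1F _ = inj₁ refl
  ⇒ 1F 0F _ = inj₂ refl
  ⇒ 1F 2F _ = inj₁ refl
  ⇒ 2F 1F _ = inj₂ refl
  ⇒ 2F 3F _ = inj₁ refl
  ⇒ 3F 2F _ = inj₂ refl
  ⇒ 3F 0F _ = inj₁ refl
  ⇒ 0F 3F _ = inj₂ refl
  ⇒ 0F 2F a = ⊥-elim (¬wy a)
  ⇒ 2F 0F a = ⊥-elim (¬wy (Adj-sym G a))
  ⇒ 1F 3F a = ⊥-elim (¬xz a)
  ⇒ 3F 1F a = ⊥-elim (¬xz (Adj-sym G a))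
  ⇒ 0F 0F a = ⊥-elim (Adj-irrefl G a)
  ⇒ 1F 1F a = ⊥-elim (Adj-irrefl G a)
  ⇒ 2F 2F a = ⊥-elim (Adj-irrefl G a)
  ⇒ 3F 3F a = ⊥-elim (Adj-irrefl G a)

  step : ∀ i j → Next i j → Adj G (f i) (f j)
  step 0F 1F _ = wx
  step 1F 2F _ = xy
  step 2F 3F _ = yz
  step 3F 0F _ = zw

  ⇐ : ∀ i j → Next i j ⊎ Next j i → Adj G (f i) (f j)
  ⇐ i j (inj₁ ij) = step i j ij
  ⇐ i j (inj₂ ji) = Adj-sym G (step j i ji)

  Adj⇒≢ : ∀ {u v} → Adj G u v → u ≢ v
  Adj⇒≢ a refl = Adj-irrefl G a

  f-injective : ∀ i j → f i ≡ f j → i ≡ j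
  f-injective 0F 0F _  = refl
  f-injective 1F 1F _  = refl
  f-injective 2F 2F _  = refl
  f-injective 3F 3F _  = refl
  f-injective 0F 1F eq = ⊥-elim (Adj⇒≢ wx eq)
  f-injective 1F 0F eq = ⊥-elim (Adj⇒≢ wx (≡.sym eq))
  f-injective 1F 2F eq = ⊥-elim (Adj⇒≢ xy eq)
  f-injective 2F 1F eq = ⊥-elim (Adj⇒≢ xy (≡.sym eq))
  f-injective 2F 3F eq = ⊥-elim (Adj⇒≢ yz eq)
  f-injective 3F 2F eq = ⊥-elim (Adj⇒≢ yz (≡.sym eq))
  f-injective 3F 0F eq = ⊥-elim (Adj⇒≢ zw eq)
  f-injective 0F 3F eq = ⊥-elim (Adj⇒≢ zw (≡.sym eq))
  f-injective 0F 2F eq = ⊥-elim (w≢y eq)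
  f-injective 2F 0F eq = ⊥-elim (w≢y (≡.sym eq))
  f-injective 1F 3F eq = ⊥-elim (x≢z eq)
  f-injective 3F 1F eq = ⊥-elim (x≢z (≡.sym eq))

differ⁺ : ∀ {n} {u v : Fin n} → u ≢ v → T (not (same u v))
differ⁺ {u = u} {v} u≢v with u Fin.≟ v
... | yes u≡v = u≢v u≡v
... | no _    = tt

differ⁻ : ∀ {n} {u v : Fin n} → T (not (same u v)) → u ≢ v
differ⁻ {u = u} t refl = subst (T ∘ not) (same-refl u) t

does-true : ∀ {P : Set} (P? : Dec P) → does P? ≡ true → P
does-true (yes p) _ = p

-- From a fill-in to a vertex cover

module FillInToCover {n : ℕ} (G : Graph n) (F : EdgeSet (n ^ 3 + n)) (fill-in : IsFillIn (construct n G) F) where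

  H⁺ : Graph (n ^ 3 + n)
  H⁺ = construct n G ⊕ F

  old : ∀ {x y} → T (adjacent G x y) → Adj H⁺ (index x) (index y)
  old {x} {y} a = from T-∨ (inj₁ (≡.subst₂ (λ x y → T (adjacent G x y))
    (≡.sym (vertex-index x)) (≡.sym (vertex-index y)) a))

  new : ∀ {x y} → ¬ T (adjacent G x y) → Adj H⁺ (index x) (index y) → T (has F (index x) (index y))
  new {x} {y} ¬a xy with to T-∨ xy
  ... | inj₁ a = ⊥-elim (¬a (≡.subst₂ (λ x y → T (adjacent G x y)) (vertex-index x) (vertex-index y) a))
  ... | inj₂ b = b

  Joined : Fin n → Fin (n ^ 2) → Set
  Joined u j = T (has F (index (inj₁ (u , j))) (index {n} (inj₂ u)))

  joined? : ∀ u → Dec (∀ j → Joined u j)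
  joined? u = Fin.all? λ j → T? _

  cover : Subset n
  cover = Vec.tabulate λ u → does (joined? u)

  ∈-cover⁺ : ∀ {u} → (∀ j → Joined u j) → u ∈ cover
  ∈-cover⁺ {u} joined = Vec.lookup⇒[]= u cover
    (trans (Vec.lookup∘tabulate _ u) (dec-true (joined? u) joined))

  ∈-cover⁻ : ∀ {u} → u ∈ cover → ∀ j → Joined u j
  ∈-cover⁻ {u} u∈ = does-true (joined? u)
    (trans (≡.sym (Vec.lookup∘tabulate (λ u → does (joined? u)) u)) (Vec.[]=⇒lookup u∈))

  missing : ∀ {u} → ¬ (∀ j → Joined u j) → ∃[ j ] ¬ Joined u j
  missing {u} = Fin.¬∀⟶∃¬ (n ^ 2) (Joined u) (λ j → T? _)

  obstruction : ∀ {u v a b} → Adj G u v → ¬ Joined u a → ¬ Joined v b → InducedCycle H⁺ 4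
  obstruction {u} {v} {a} {b} uv ¬ua ¬vb = four-cycle H⁺
    {index {n} (inj₂ u)} {index {n} (inj₂ v)} {index (inj₁ (u , a))} {index (inj₁ (v , b))}
    (old {inj₂ u} {inj₂ v} uv)
    -- Each copy meets the block of the other vertex already in `H`; only the two diagonals are
    -- pairs of a copy and its own block.
    (old {inj₂ v} {inj₁ (u , a)} (differ⁺ (u≢v ∘ ≡.sym)))
    (old {inj₁ (u , a)} {inj₁ (v , b)} block-clique)
    (old {inj₁ (v , b)} {inj₂ u} (differ⁺ (u≢v ∘ ≡.sym)))
    (λ eq → case index-injective {x = inj₂ u} {inj₁ (u , a)} eq of λ ())
    (λ eq → case index-injective {x = inj₂ v} {inj₁ (v , b)} eq of λ ())
    (own ¬ua) (own ¬vb)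
    where
    u≢v : u ≢ v
    u≢v refl = Adj-irrefl G uv
    block-clique : T (not (same u v ∧ same a b))
    block-clique with u Fin.≟ v
    ... | yes u≡v = ⊥-elim (u≢v u≡v)
    ... | no _    = tt
    own : ∀ {u j} → ¬ Joined u j → ¬ Adj H⁺ (index {n} (inj₂ u)) (index (inj₁ (u , j)))
    own {u} {j} ¬uj a = ¬uj (new {inj₁ (u , j)} {inj₂ u} (λ t → differ⁻ {u = u} t refl) (Adj-sym H⁺ a))

  cover-ok : IsVertexCover G cover
  cover-ok u v uv with joined? u | joined? v
  ... | yes ju | _      = inj₁ (∈-cover⁺ ju)
  ... | no _   | yes jv = inj₂ (∈-cover⁺ jv)
  ... | no ¬ju | no ¬jv = ⊥-elim (proj₂ fill-in 4 ≤-refl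
    (obstruction uv (proj₂ (missing ¬ju)) (proj₂ (missing ¬jv))))

  cover-size : ∣ cover ∣ * n ^ 2 ≤ size F
  cover-size = ≤-trans (≤-reflexive (≡.sym (length-blockEdges cover)))
    (unique-⊆-length (blockEdges-unique cover) edges)
    where
    edges : ∀ {e} → e List.∈ blockEdges cover → e List.∈ edgeList F
    edges e∈ with ∈-map⁻ _ e∈
    ... | (u , j) , uj∈ , refl = ∈-edgeList⁺ F (block<copy (u , j) u)
      (∈-cover⁻ (∈-elements⁻ cover (proj₁ (∈-cartesianProduct⁻ (elements cover) (allFin (n ^ 2)) uj∈))) j)

-- From a vertex cover to a fill-in

pairs : ∀ n → List (Fin n × Fin n)
pairs n = drop 1 (cartesianProduct (allFin n) (allFin n))

-- This is the source of the `∸ 1` in the budget: for positive `n` the dropped head is the diagonal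
-- pair of `zero`, which is never an edge.
length-pairs : ∀ n → length (pairs n) ≡ n ^ 2 ∸ 1
length-pairs n = trans (length-drop 1 (cartesianProduct (allFin n) (allFin n))) (cong (_∸ 1)
  (trans (length-cartesianProduct (allFin n) (allFin n))
    (cong₂ _*_ (length-tabulate {n = n} (λ u → u))
               (trans (length-tabulate {n = n} (λ u → u)) (≡.sym (*-identityʳ n))))))

∈-pairs : ∀ {n} {u v : Fin n} → u ≢ v → (u , v) List.∈ pairs n
∈-pairs {suc n} {u} {v} u≢v with ∈-cartesianProduct⁺ (∈-allFin u) (∈-allFin v)
... | here refl = ⊥-elim (u≢v refl)
... | there uv∈ = uv∈

module CoverToFillIn {n : ℕ} (G : Graph n) (S : Subset n) (S-cover : IsVertexCover G S) where

  member : Fin n → Bool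
  member u = does (u ∈? S)

  member⁻ : ∀ {u} → T (member u) → u ∈ S
  member⁻ {u} t with u ∈? S
  ... | yes u∈S = u∈S

  fill : Vertex n → Vertex n → Bool
  fill (inj₁ _)       (inj₁ _)       = false
  fill (inj₁ (u , _)) (inj₂ v)       = same u v ∧ member v
  fill (inj₂ u)       (inj₁ (v , _)) = same u v ∧ member u
  fill (inj₂ u)       (inj₂ v)       = (not (same u v) ∧ not (has (E G) u v)) ∧ (member u ∧ member v)

  fill-sym : ∀ x y → fill x y ≡ fill y x
  fill-sym (inj₁ _)       (inj₁ _)       = refl
  fill-sym (inj₁ (u , _)) (inj₂ v)       = cong (_∧ member v) (same-sym u v)
  fill-sym (inj₂ u)       (inj₁ (v , _)) = cong (_∧ member u) (same-sym u v)
  fill-sym (inj₂ u)       (inj₂ v)       = cong₂ _∧_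
    (cong₂ (λ a b → not a ∧ not b) (same-sym u v) (sym (E G) u v)) (∧-comm (member u) (member v))

  fill-irrefl : ∀ x → fill x x ≡ false
  fill-irrefl (inj₁ _) = refl
  fill-irrefl (inj₂ u) rewrite same-refl u = refl

  F : EdgeSet (n ^ 3 + n)
  F = record
    { has    = λ i j → fill (vertex i) (vertex j)
    ; sym    = λ i j → fill-sym (vertex i) (vertex j)
    ; irrefl = λ i → fill-irrefl (vertex i)
    }

  fill-disjoint : ∀ x y → T (fill x y) → ¬ T (adjacent G x y)
  fill-disjoint (inj₁ (u , _)) (inj₂ v)       f a with u Fin.≟ v
  ... | yes _ = a
  ... | no _  = f
  fill-disjoint (inj₂ u)       (inj₁ (v , _)) f a with u Fin.≟ v
  ... | yes _ = a
  ... | no _  = f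
  fill-disjoint (inj₂ u)       (inj₂ v)       f a with same u v | has (E G) u v
  ... | false | true = f
  ... | true  | true = f

  Core : Vertex n → Set
  Core (inj₁ _) = ⊤
  Core (inj₂ u) = u ∈ S

  core? : ∀ x → Dec (Core x)
  core? (inj₁ _) = yes tt
  core? (inj₂ u) = u ∈? S

  core-clique : ∀ x y → Core x → Core y → x ≢ y → T (adjacent G x y ∨ fill x y)
  core-clique (inj₁ (u , i)) (inj₁ (v , j)) _ _ x≢y with u Fin.≟ v
  ... | no _ = tt
  ... | yes refl with i Fin.≟ j
  ...   | no _     = tt
  ...   | yes refl = x≢y refl
  core-clique (inj₁ (u , _)) (inj₂ v) _ v∈S _ with u Fin.≟ v | v ∈? S
  ... | no _  | _      = tt
  ... | yes _ | yes _  = tt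
  ... | yes _ | no v∉S = v∉S v∈S
  core-clique (inj₂ u) (inj₁ (v , _)) u∈S _ _ with u Fin.≟ v | u ∈? S
  ... | no _  | _      = tt
  ... | yes _ | yes _  = tt
  ... | yes _ | no u∉S = u∉S u∈S
  core-clique (inj₂ u) (inj₂ v) u∈S v∈S x≢y with has (E G) u v | u Fin.≟ v | u ∈? S | v ∈? S
  ... | true  | _        | _      | _      = tt
  ... | false | yes refl | _      | _      = x≢y refl
  ... | false | no _     | no u∉S | _      = u∉S u∈S
  ... | false | no _     | yes _  | no v∉S = v∉S v∈S
  ... | false | no _     | yes _  | yes _  = tt

  -- Only two copies outside `S` are at issue: an edge of `G` between them would be uncovered, and a
  -- fill edge between copies has both ends in `S`.
  non-core-independent : ∀ x y → ¬ Core x → ¬ Core y → ¬ T (adjacent G x y ∨ fill x y)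
  non-core-independent (inj₁ _) y        ¬x _  _ = ¬x tt
  non-core-independent (inj₂ _) (inj₁ _) _  ¬y _ = ¬y tt
  non-core-independent (inj₂ u) (inj₂ v) u∉S v∉S t with to T-∨ t
  ... | inj₁ uv = [ u∉S , v∉S ]′ (S-cover u v uv)
  ... | inj₂ f  = u∉S (member⁻ (proj₁ (to T-∧ (proj₂ (to (T-∧ {not (same u v) ∧ not (has (E G) u v)}) f)))))

  fill-in : IsFillIn (construct n G) F
  fill-in = (λ i j → fill-disjoint (vertex i) (vertex j)) ,
    split-chordal (construct n G ⊕ F) (λ i → core? (vertex {n} i))
      (λ {i} {j} ci cj i≢j → core-clique (vertex {n} i) (vertex j) ci cj
        (λ eq → i≢j (trans (≡.sym (index-vertex {n} i)) (trans (cong (index {n}) eq) (index-vertex {n} j)))))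
      (λ {i} {j} → non-core-independent (vertex i) (vertex j))

  possibleEdges : List (Fin (n ^ 3 + n) × Fin (n ^ 3 + n))
  possibleEdges = blockEdges S ++ map (λ (u , v) → index {n} (inj₂ u) , index {n} (inj₂ v)) (pairs n)

  fill-possible : ∀ x y → toℕ (index x) < toℕ (index y) → T (fill x y) →
                  (index x , index y) List.∈ possibleEdges
  fill-possible (inj₁ (u , j)) (inj₂ v) _ f with u Fin.≟ v
  ... | yes refl = ∈-++⁺ˡ (∈-map⁺ _ (∈-cartesianProduct⁺ (∈-elements⁺ (member⁻ f)) (∈-allFin j)))
  -- Block vertices precede copies in the numbering, so this orientation never occurs.
  fill-possible (inj₂ u) (inj₁ p) x<y _ = ⊥-elim (<-asym x<y (block<copy p u))
  fill-possible (inj₂ u) (inj₂ v) _ f = ∈-++⁺ʳ (blockEdges S)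
    (∈-map⁺ _ (∈-pairs (differ⁻ (proj₁ (to T-∧ (proj₁ (to T-∧ f)))))))

  fill-size : size F ≤ ∣ S ∣ * n ^ 2 + (n ^ 2 ∸ 1)
  fill-size = ≤-trans (unique-⊆-length (edgeList-unique F) possible)
    (≤-reflexive (trans (length-++ (blockEdges S))
      (cong₂ _+_ (length-blockEdges S) (trans (length-map _ (pairs n)) (length-pairs n)))))
    where
    possible : ∀ {e} → e List.∈ edgeList F → e List.∈ possibleEdges
    possible {i , j} e∈ with i<j , f ← ∈-edgeList⁻ F e∈ =
      ≡.subst₂ (λ i j → (i , j) List.∈ possibleEdges) (index-vertex {n} i) (index-vertex {n} j)
        (fill-possible (vertex {n} i) (vertex {n} j)
          (≡.subst₂ (λ i j → toℕ {n ^ 3 + n} i < toℕ {n ^ 3 + n} j) (≡.sym (index-vertex {n} i)) (≡.sym (index-vertex {n} j)) i<j) f)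

cover⇔fill-in : ∀ n .{{_ : NonZero n}} (G : Graph n) (c : ℕ) → c ≤ n →
  HasVertexCoverOfSize G c ⇔ HasFillInOfSizeAtMost (construct n G) ((c + 1) * n ^ 2 ∸ 1)
cover⇔fill-in n G c c≤n = mk⇔ forwards backwards
  where
  budget : (c + 1) * n ^ 2 ≡ c * n ^ 2 + n ^ 2
  budget = trans (*-distribʳ-+ (n ^ 2) c 1) (cong (c * n ^ 2 +_) (*-identityˡ (n ^ 2)))

  forwards : HasVertexCoverOfSize G c → HasFillInOfSizeAtMost (construct n G) ((c + 1) * n ^ 2 ∸ 1)
  -- Moving the truncated `∸ 1` across the sum requires `n ^ 2` to be positive, hence `n` nonzero.
  forwards (S , S-cover , refl) = F , fill-in , ≤-trans fill-size (≤-reflexive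
    (≡.sym (trans (cong (_∸ 1) budget) (+-∸-assoc (c * n ^ 2) (m^n>0 n 2)))))
    where open CoverToFillIn G S S-cover

  backwards : HasFillInOfSizeAtMost (construct n G) ((c + 1) * n ^ 2 ∸ 1) → HasVertexCoverOfSize G c
  backwards (F , fill-in , F≤) =
    let S , cover⊆S , ∣S∣≡c = enlarge cover small c≤n
    in S , (λ u v uv → Sum.map cover⊆S cover⊆S (cover-ok u v uv)) , ∣S∣≡c
    where
    open FillInToCover G F fill-in
    positive : 1 ≤ (c + 1) * n ^ 2
    positive = ≤-trans (m^n>0 n 2) (≤-trans (m≤n+m _ (c * n ^ 2)) (≤-reflexive (≡.sym budget)))
    small : ∣ cover ∣ ≤ c
    -- The `∸ 1` makes the comparison with `(c + 1) * n ^ 2` strict; cancelling `n ^ 2` leaves fewer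
    -- than `c + 1` vertices in the cover.
    small = s≤s⁻¹ (≤-trans (*-cancelʳ-< (n ^ 2) ∣ cover ∣ (c + 1) (begin-strict
      ∣ cover ∣ * n ^ 2     ≤⟨ cover-size ⟩
      size F                ≤⟨ F≤ ⟩
      (c + 1) * n ^ 2 ∸ 1   <⟨ ∸-monoʳ-< {o = 0} ≤-refl positive ⟩
      (c + 1) * n ^ 2       ∎)) (≤-reflexive (+-comm c 1)))
      where open ≤-Reasoning

theorem1p4 : Σ (∀ n → Graph n → Graph (n ^ 3 + n)) λ construct →
    PolynomialTime construct ×
    (∀ n .{{_ : NonZero n}} (G : Graph n) (c : ℕ) → c ≤ n →
    HasVertexCoverOfSize G c ⇔
    HasFillInOfSizeAtMost (construct n G) ((c + 1) * n ^ 2 ∸ 1))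
theorem1p4 = construct , construct-polynomial , cover⇔fill-in
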